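{- For each integer $g\geq 2$ there exists a large set of H-designs LH$(10,g,4,3)$.
   Context: An H-design H$(n,g,k,t)$ is a triple $(Q,G,B)$ where $Q$ is a set of $ng$ points, $G$ is a partition of $Q$ into $n$ groups of size $g$, and $B$ is a set of $k$-subsets of $Q$ (blocks) such that each block meets each group in at most one point and any $t$ points from $t$ distinct groups lie in exactly one block. A large set of H-designs LH$(n,g,k,t)$ is a partition of the set of all $k$-subsets of $Q$ meeting each group of $G$ in at most one point into pairwise disjoint block sets, each of which forms (with $Q$ and $G$) an H-design H$(n,g,k,t)$. -}

module Defs where

open import Data.Fin.Base using (Fin)
open import Data.Fin.Subset using (Subset; _∈_; _⊆_; _∩_; ∣_∣)
open import Data.Nat.Base using (ℕ; _*_; _≤_)
open import Data.Product using (_×_; ∃!)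
open import Level using (Level; 0ℓ; suc; _⊔_)
open import Relation.Binary.PropositionalEquality.Core using (_≡_)
open import Relation.Unary using (Pred; U; Satisfiable)
  renaming (_∈_ to _∈ᵖ_; _⊆_ to _⊆ᵖ_)

private
  variable
    a i ℓ ℓ′ : Level
    n g : ℕ

-- Because the parts are nonempty and each element has a unique index, distinct
-- indices give distinct parts, so an indexed family really is a set of parts.
record IsPartition {A : Set a} {I : Set i} (P : Pred A ℓ) (part : I → Pred A ℓ′)
                   : Set (a ⊔ i ⊔ ℓ ⊔ ℓ′) where
  field
    nonempty : ∀ j → Satisfiable (part j)
    within   : ∀ j → part j ⊆ᵖ P
    covers   : ∀ {x} → x ∈ᵖ P → ∃! _≡_ (λ j → x ∈ᵖ part j)

record Grouping (n g : ℕ) : Set where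
  field
    group       : Fin n → Subset (n * g)
    isPartition : IsPartition U (λ j → _∈ group j)
    size        : ∀ j → ∣ group j ∣ ≡ g

-- The k-subsets of the point set meeting each group in at most one point;
-- equivalently, sets of k points from k distinct groups.
Transverse : Grouping n g → ℕ → Pred (Subset (n * g)) 0ℓ
Transverse G k s = ∣ s ∣ ≡ k × (∀ j → ∣ s ∩ group j ∣ ≤ 1)
  where open Grouping G

-- B is the set of blocks of an H-design H(n,g,k,t) on the points Fin (n * g)
-- with groups G.
record IsHDesign (G : Grouping n g) (k t : ℕ) (B : Pred (Subset (n * g)) 0ℓ) : Set where
  field
    transverse : B ⊆ᵖ Transverse G k
    balanced   : ∀ {T} → T ∈ᵖ Transverse G t →
                 ∃! _≡_ (λ b → b ∈ᵖ B × T ⊆ b)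

record LH (n g k t : ℕ) : Set (suc 0ℓ) where
  field
    grouping    : Grouping n g
    number      : ℕ
    blocks      : Fin number → Pred (Subset (n * g)) 0ℓ
    isHDesign   : ∀ j → IsHDesign grouping k t (blocks j)
    isPartition : IsPartition (Transverse grouping k) blocks

{-# OPTIONS --safe #-}
module Submission where

-- Let 7g Steiner quadruple systems SQS(10) contain every quadruple exactly g
-- times in total.  Label the points of every group by residues mod g.  A
-- transverse quadruple lies over a quadruple A of groups; send it to the i-th of
-- the g systems containing A, where i is the sum of its labels.  Given a transverse
-- triple and a system, the system determines the fourth group and i determines the
-- label in it, so the classes are H-designs.  Such multisets of systems can be
-- united, which adds their multiplicities, so it suffices to have them for g = 2
-- and g = 3.

open import Defs

import Data.Bool.Properties as Bool
open import Data.Fin.Base using (Fin; zero; suc; toℕ; _↑ˡ_; _↑ʳ_)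
open import Data.Fin.Patterns
open import Data.Fin.Properties as Fin using (toℕ-injective; toℕ<n; toℕ-fromℕ<; +↔⊎)
open import Data.Fin.Subset
open import Data.Fin.Subset.Properties hiding (_∈?_)
open import Data.List.Base as List using (List; []; _∷_; allFin; concatMap; drop; filter; head; length)
import Data.List.Membership.DecPropositional as DecMembership
import Data.List.Membership.Propositional as List
open import Data.List.Membership.Propositional using (find; lose)
open import Data.List.Membership.Propositional.Properties
open import Data.List.Relation.Unary.All as All using (All)
open import Data.List.Relation.Unary.Any using (here; there)
open import Data.Maybe.Base using (Maybe; just; nothing; is-just; fromMaybe)
open import Data.Nat.Base using (ℕ; zero; suc; pred; _+_; _*_; _≤_; _≥_; z≤n; s≤s; s≤s⁻¹; NonZero; _%_)
open import Data.Nat.DivMod using (_mod_; %-distribˡ-+; m%n%n≡m%n; [m+kn]%n≡m%n; m<n⇒m%n≡m)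
open import Data.Nat.Properties as ℕ
  using (suc-injective; suc-pred; *-suc; +-assoc; +-comm; +-identityʳ; ≤-trans; ≤-reflexive; <-irrefl; m≤m+n; m≤n+m)
open import Data.Product using (∃; ∃!; _×_; _,_; proj₂; map₂)
open import Data.Sum.Base as Sum using (_⊎_; inj₁; inj₂)
open import Data.Sum.Properties using (inj₁-injective; inj₂-injective)
open import Data.Vec.Base as Vec using (Vec; []; _∷_; _∷ʳ_; _++_; here; there; lookup; map)
open import Data.Vec.Properties
  using (++-injective; ∷-injectiveʳ; zipWith-++; lookup-++ˡ; lookup-++ʳ; []=⇒lookup; lookup⇒[]=; ≡-dec)
open import Function.Base using (_∘_; _$_)
open import Function.Bundles using (_↔_; Inverse)
open import Function.Construct.Symmetry using (↔-sym)
open import Relation.Binary.PropositionalEquality hiding (J)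
open import Relation.Nullary using (Dec; contradiction)
open import Relation.Nullary.Decidable using (True; toWitness)

private
  variable
    m n k g μ : ℕ
    I I′ J J′ X : Set
    T A : Subset n
    s : Side

-- Covering pairs of subsets, and colourings

infix 4 _⋖_

-- The covering relation of the subset lattice. It is inductive so that a proof marks the added
-- position, where `fill` later puts a label.
data _⋖_ : Subset n → Subset n → Set where
  here  : outside ∷ T ⋖ inside ∷ T
  there : T ⋖ A → s ∷ T ⋖ s ∷ A

⋖-size : T ⋖ A → ∣ A ∣ ≡ suc ∣ T ∣
⋖-size here                    = refl
⋖-size (there {s = outside} p) = ⋖-size p
⋖-size (there {s = inside}  p) = cong suc (⋖-size p)

-- colour A i is the i-th system containing A, for J indexing the systems and I the
-- |I| occurrences of A in them.
record Colouring (n k : ℕ) (I J : Set) : Set where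
  field
    colour   : Subset n → I → J
    balanced : ∀ {T : Subset n} → ∣ T ∣ ≡ k → ∀ j →
               ∃! _≡_ λ ((A , i) : Subset n × I) → T ⋖ A × colour A i ≡ j

-- Union of two multisets of systems. `Sum.map` preserves the side, so an occurrence coloured by a
-- system of one multiset belongs to that multiset, and balance is inherited on each side
-- separately.
_⊎-colouring_ : Colouring n k I J → Colouring n k I′ J′ → Colouring n k (I ⊎ I′) (J ⊎ J′)
_⊎-colouring_ {n = n} {k = k} {I = I} {J = J} {I′ = I′} {J′ = J′} C C′ = record
  { colour = λ A → Sum.map (C.colour A) (C′.colour A); balanced = bal }
  where
  module C  = Colouring C
  module C′ = Colouring C′
  bal : ∀ {T : Subset n} → ∣ T ∣ ≡ k → ∀ j → ∃! _≡_ λ ((A , i) : Subset n × (I ⊎ I′)) →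
        T ⋖ A × Sum.map (C.colour A) (C′.colour A) i ≡ j
  bal T# (inj₁ j) with C.balanced T# j
  ... | (A , i) , (T⋖A , eq) , unique = (A , inj₁ i) , (T⋖A , cong inj₁ eq) , λ
    { {B , inj₁ i′} (T⋖B , eq′) → cong (map₂ inj₁) (unique (T⋖B , inj₁-injective eq′)) }
  bal T# (inj₂ j) with C′.balanced T# j
  ... | (A , i) , (T⋖A , eq) , unique = (A , inj₂ i) , (T⋖A , cong inj₂ eq) , λ
    { {B , inj₂ i′} (T⋖B , eq′) → cong (map₂ inj₂) (unique (T⋖B , inj₂-injective eq′)) }

-- Serves to turn the sums of index types produced by `_⊎-colouring_` back into `Fin`.
reindex : I ↔ I′ → J ↔ J′ → Colouring n k I J → Colouring n k I′ J′
reindex {n = n} {k = k} I↔ J↔ C = record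
  { colour   = colour′
  ; balanced = balanced′
  }
  where
  open Colouring C
  module I = Inverse I↔
  module J = Inverse J↔
  colour′ = λ A i → J.to (colour A (I.from i))
  balanced′ : ∀ {T : Subset n} → ∣ T ∣ ≡ k → ∀ j → ∃! _≡_ λ (A , i) → T ⋖ A × colour′ A i ≡ j
  balanced′ T# j with balanced T# (J.from j)
  ... | (A , i) , (T⋖A , eq) , unique
      = (A , I.to i)
      , (T⋖A , trans (cong (λ x → J.to (colour A x)) (I.strictlyInverseʳ i)) (J.inverseˡ eq))
      , λ (T⋖B , eq′) → trans (cong (map₂ I.to) (unique (T⋖B , sym (J.inverseʳ (sym eq′)))))
                              (cong (_ ,_) (I.strictlyInverseˡ _))

-- Subsets of a concatenation

∣++∣ : ∀ (S : Subset m) (T : Subset n) → ∣ S ++ T ∣ ≡ ∣ S ∣ + ∣ T ∣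
∣++∣ []            T = refl
∣++∣ (outside ∷ S) T = ∣++∣ S T
∣++∣ (inside  ∷ S) T = cong suc (∣++∣ S T)

∣++∩++∣ : ∀ (S S′ : Subset m) (T T′ : Subset n) →
          ∣ (S ++ T) ∩ (S′ ++ T′) ∣ ≡ ∣ S ∩ S′ ∣ + ∣ T ∩ T′ ∣
∣++∩++∣ S S′ T T′ = trans (cong ∣_∣ (zipWith-++ _ S T S′ T′)) (∣++∣ (S ∩ S′) (T ∩ T′))

≤1⇒⊥⊎⁅⁆ : (S : Subset m) → ∣ S ∣ ≤ 1 → S ≡ ⊥ ⊎ ∃ λ x → S ≡ ⁅ x ⁆
≤1⇒⊥⊎⁅⁆ []            _ = inj₁ refl
≤1⇒⊥⊎⁅⁆ (inside  ∷ S) p = inj₂ (zero , cong (inside ∷_) (empty S (s≤s⁻¹ p)))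
  where
  empty : ∀ {m} (S : Subset m) → ∣ S ∣ ≤ 0 → S ≡ ⊥
  empty []            _ = refl
  empty (outside ∷ S) p = cong (outside ∷_) (empty S p)
≤1⇒⊥⊎⁅⁆ (outside ∷ S) p with ≤1⇒⊥⊎⁅⁆ S p
... | inj₁ eq       = inj₁ (cong (outside ∷_) eq)
... | inj₂ (x , eq) = inj₂ (suc x , cong (outside ∷_) eq)

module _ {S : Subset m} {T : Subset n} where

  ∈-++ˡ⁺ : ∀ {x} → x ∈ S → x ↑ˡ n ∈ S ++ T
  ∈-++ˡ⁺ {x} x∈S = lookup⇒[]= (x ↑ˡ n) (S ++ T) (trans (lookup-++ˡ S T x) ([]=⇒lookup x∈S))

  ∈-++ˡ⁻ : ∀ {x} → x ↑ˡ n ∈ S ++ T → x ∈ S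
  ∈-++ˡ⁻ {x} x∈S++T = lookup⇒[]= x S (trans (sym (lookup-++ˡ S T x)) ([]=⇒lookup x∈S++T))

  ∈-++ʳ⁺ : ∀ {x} → x ∈ T → m ↑ʳ x ∈ S ++ T
  ∈-++ʳ⁺ {x} x∈T = lookup⇒[]= (m ↑ʳ x) (S ++ T) (trans (lookup-++ʳ S T x) ([]=⇒lookup x∈T))

  ∈-++ʳ⁻ : ∀ {x} → m ↑ʳ x ∈ S ++ T → x ∈ T
  ∈-++ʳ⁻ {x} x∈S++T = lookup⇒[]= x T (trans (sym (lookup-++ʳ S T x)) ([]=⇒lookup x∈S++T))

data SplitView (m : ℕ) {n} : Fin (m + n) → Set where
  left  : (x : Fin m) → SplitView m (x ↑ˡ n)
  right : (x : Fin n) → SplitView m (m ↑ʳ x)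

splitView : ∀ m {n} (x : Fin (m + n)) → SplitView m x
splitView zero    x       = right x
splitView (suc m) zero    = left zero
splitView (suc m) (suc x) with splitView m x
... | left  y = left (suc y)
... | right y = right y

++-⊆⁺ : ∀ {S S′ : Subset m} {T T′ : Subset n} → S ⊆ S′ → T ⊆ T′ → S ++ T ⊆ S′ ++ T′
++-⊆⁺ {m = m} {S = S} {S′ = S′} S⊆S′ T⊆T′ {x} x∈ with splitView m x
... | left  y = ∈-++ˡ⁺ (S⊆S′ (∈-++ˡ⁻ x∈))
... | right y = ∈-++ʳ⁺ {S = S′} (T⊆T′ (∈-++ʳ⁻ {S = S} x∈))

-- The groups as consecutive intervals of length g

fibre : ∀ n g → Fin n → Subset (n * g)
fibre (suc n) g zero    = ⊤ {g} ++ ⊥ {n * g}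
fibre (suc n) g (suc j) = ⊥ {g} ++ fibre n g j

fibre-size : ∀ n g j → ∣ fibre n g j ∣ ≡ g
fibre-size (suc n) g zero    = begin
  ∣ ⊤ {g} ++ ⊥ {n * g} ∣     ≡⟨ ∣++∣ (⊤ {g}) (⊥ {n * g}) ⟩
  ∣ ⊤ {g} ∣ + ∣ ⊥ {n * g} ∣  ≡⟨ cong₂ _+_ (∣⊤∣≡n g) (∣⊥∣≡0 (n * g)) ⟩
  g + 0                      ≡⟨ +-identityʳ g ⟩
  g                          ∎
  where open ≡-Reasoning
fibre-size (suc n) g (suc j) =
  trans (∣++∣ (⊥ {g}) (fibre n g j)) (cong₂ _+_ (∣⊥∣≡0 g) (fibre-size n g j))

fibre-nonempty : ∀ n g .{{_ : NonZero g}} j → Nonempty (fibre n g j)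
fibre-nonempty (suc n) g zero    = (0 mod g) ↑ˡ (n * g) , ∈-++ˡ⁺ {S = ⊤ {g}} ∈⊤
fibre-nonempty (suc n) g (suc j) with fibre-nonempty n g j
... | x , x∈ = g ↑ʳ x , ∈-++ʳ⁺ {S = ⊥ {g}} x∈

fibre-covers : ∀ n g (x : Fin (n * g)) → ∃! _≡_ λ j → x ∈ fibre n g j
fibre-covers (suc n) g x with splitView g x
... | left y = zero , ∈-++ˡ⁺ {S = ⊤ {g}} ∈⊤ , λ
  { {zero}  _  → refl
  ; {suc j} y∈ → contradiction (∈-++ˡ⁻ {S = ⊥ {g}} y∈) ∉⊥
  }
... | right y with fibre-covers n g y
...   | j , y∈ , unique = suc j , ∈-++ʳ⁺ {S = ⊥ {g}} y∈ , λ
  { {zero}  y∈′ → contradiction (∈-++ʳ⁻ {S = ⊤ {g}} y∈′) ∉⊥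
  ; {suc i} y∈′ → cong suc (unique (∈-++ʳ⁻ {S = ⊥ {g}} y∈′))
  }

fibres : ∀ n g → .{{_ : NonZero g}} → Grouping n g
fibres n g = record
  { group       = fibre n g
  ; isPartition = record
    { nonempty = fibre-nonempty n g
    ; within   = _
    ; covers   = λ {x} _ → fibre-covers n g x
    }
  ; size        = fibre-size n g
  }

-- Transverse sets as words

module _ {g : ℕ} where

  -- Encodes a transverse set: entry `j` is the label of its point in group `j`, or `nothing` if it
  -- misses that group.
  Word : ℕ → Set
  Word = Vec (Maybe (Fin g))

  private
    variable
      c d : Maybe (Fin g)
      t w : Word n

  shape : Word n → Subset n
  shape = map is-just

  cell : Maybe (Fin g) → Subset g
  cell nothing  = ⊥
  cell (just x) = ⁅ x ⁆

  points : Word n → Subset (n * g)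
  points []      = []
  points (c ∷ w) = cell c ++ points w

  ∣points∣ : (w : Word n) → ∣ points w ∣ ≡ ∣ shape w ∣
  ∣points∣ []            = refl
  ∣points∣ (nothing ∷ w) = trans (∣++∣ (⊥ {g}) (points w)) (cong₂ _+_ (∣⊥∣≡0 g) (∣points∣ w))
  ∣points∣ (just x  ∷ w) = trans (∣++∣ ⁅ x ⁆ (points w)) (cong₂ _+_ (∣⁅x⁆∣≡1 x) (∣points∣ w))

  cell-size : ∀ c → ∣ cell c ∣ ≤ 1
  cell-size nothing  = ≤-trans (≤-reflexive (∣⊥∣≡0 g)) z≤n
  cell-size (just x) = ≤-reflexive (∣⁅x⁆∣≡1 x)

  cell-⊆⁻ : ∀ {x} → cell (just x) ⊆ cell d → just x ≡ d
  cell-⊆⁻ {d = nothing} {x} p = contradiction (p (x∈⁅x⁆ x)) ∉⊥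
  cell-⊆⁻ {d = just y}  {x} p = cong just (x∈⁅y⁆⇒x≡y y (p (x∈⁅x⁆ x)))

  cell-injective : cell c ≡ cell d → c ≡ d
  cell-injective {just x}  {d}       eq = cell-⊆⁻ (⊆-reflexive eq)
  cell-injective {nothing} {just y}  eq = sym (cell-⊆⁻ (⊆-reflexive (sym eq)))
  cell-injective {nothing} {nothing} eq = refl

  points-injective : ∀ (t w : Word n) → points t ≡ points w → t ≡ w
  points-injective []      []      eq = refl
  points-injective (c ∷ t) (d ∷ w) eq with ++-injective (cell c) (cell d) eq
  ... | eq₁ , eq₂ = cong₂ _∷_ (cell-injective eq₁) (points-injective t w eq₂)

  points∩fibre : ∀ (w : Word n) j → ∣ points w ∩ fibre n g j ∣ ≤ 1
  points∩fibre {suc n} (c ∷ w) zero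
    rewrite ∣++∩++∣ (cell c) ⊤ (points w) (⊥ {n * g}) | ∩-identityʳ (cell c)
          | ∩-zeroʳ (points w) | ∣⊥∣≡0 (n * g) | +-identityʳ ∣ cell c ∣
    = cell-size c
  points∩fibre {suc n} (c ∷ w) (suc j)
    rewrite ∣++∩++∣ (cell c) ⊥ (points w) (fibre n g j) | ∩-zeroʳ (cell c) | ∣⊥∣≡0 g
    = points∩fibre w j

  -- Cut off the first `g` coordinates: the bound for group `zero` leaves at most one point there,
  -- and the bounds for the other groups pass to the rest.
  toWord : ∀ n (S : Subset (n * g)) → (∀ j → ∣ S ∩ fibre n g j ∣ ≤ 1) → ∃ λ w → S ≡ points {n} w
  toWord zero    [] _ = [] , refl
  toWord (suc n) S  p with Vec.splitAt g S
  ... | R , R′ , refl with toWord n R′ q | ≤1⇒⊥⊎⁅⁆ R r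
    where
    q : ∀ j → ∣ R′ ∩ fibre n g j ∣ ≤ 1
    q j = ≤-trans (≤-trans (m≤n+m _ ∣ R ∩ ⊥ ∣)
                           (≤-reflexive (sym (∣++∩++∣ R ⊥ R′ (fibre n g j))))) (p (suc j))
    r : ∣ R ∣ ≤ 1
    r = ≤-trans (≤-trans (≤-reflexive (cong ∣_∣ (sym (∩-identityʳ R))))
                (≤-trans (m≤m+n _ ∣ R′ ∩ ⊥ ∣) (≤-reflexive (sym (∣++∩++∣ R ⊤ R′ ⊥))))) (p zero)
  ... | w , refl | inj₁ refl       = nothing ∷ w , refl
  ... | w , refl | inj₂ (x , refl) = just x  ∷ w , refl

  infix 4 _◃_

  data _◃_ : Word n → Word n → Set where
    here  : ∀ {x} → nothing ∷ w ◃ just x ∷ w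
    there : t ◃ w → c ∷ t ◃ c ∷ w

  ◃⇒⊆ : t ◃ w → points t ⊆ points w
  ◃⇒⊆ (here {x = x})    = ++-⊆⁺ (⊆-min ⁅ x ⁆) ⊆-refl
  ◃⇒⊆ (there {c = c} p) = ++-⊆⁺ {S = cell c} ⊆-refl (◃⇒⊆ p)

  ◃⇒⋖ : t ◃ w → shape t ⋖ shape w
  ◃⇒⋖ here      = here
  ◃⇒⋖ (there p) = there (◃⇒⋖ p)

  points-⊆⁻ : ∀ (c d : Maybe (Fin g)) (t w : Word n) → points (c ∷ t) ⊆ points (d ∷ w) →
              cell c ⊆ cell d × points t ⊆ points w
  points-⊆⁻ c d t w p =
    (λ x∈ → ∈-++ˡ⁻ (p (∈-++ˡ⁺ x∈))) , λ x∈ → ∈-++ʳ⁻ {S = cell d} (p (∈-++ʳ⁺ {S = cell c} x∈))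

  shape-⊆ : ∀ (t w : Word n) → points t ⊆ points w → ∣ shape t ∣ ≤ ∣ shape w ∣
  shape-⊆ t w p = subst₂ _≤_ (∣points∣ t) (∣points∣ w) (p⊆q⇒∣p∣≤∣q∣ p)

  ⊆⇒≡ : ∀ (t w : Word n) → points t ⊆ points w → ∣ shape w ∣ ≤ ∣ shape t ∣ → t ≡ w
  ⊆⇒≡ []      []      _ _  = refl
  ⊆⇒≡ (c ∷ t) (d ∷ w) p sz with points-⊆⁻ c d t w p
  ⊆⇒≡ (nothing ∷ t) (nothing ∷ w) _ sz | _ , p = cong (nothing ∷_) (⊆⇒≡ t w p sz)
  ⊆⇒≡ (nothing ∷ t) (just y  ∷ w) _ sz | _ , p = contradiction (≤-trans sz (shape-⊆ t w p)) (<-irrefl refl)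
  ⊆⇒≡ (just x  ∷ t) (d       ∷ w) _ sz | q , p with refl ← cell-⊆⁻ {d = d} q =
    cong (just x ∷_) (⊆⇒≡ t w p (s≤s⁻¹ sz))

  -- The first group that `w` meets and `t` misses uses up the difference in size, so beyond it the
  -- words agree by `⊆⇒≡`.
  ⊆⇒◃ : ∀ (t w : Word n) → points t ⊆ points w → ∣ shape w ∣ ≡ suc ∣ shape t ∣ → t ◃ w
  ⊆⇒◃ (c ∷ t) (d ∷ w) p sz with points-⊆⁻ c d t w p
  ⊆⇒◃ (nothing ∷ t) (nothing ∷ w) _ sz | _ , p = there (⊆⇒◃ t w p sz)
  ⊆⇒◃ (nothing ∷ t) (just y  ∷ w) _ sz | _ , p
    with refl ← ⊆⇒≡ t w p (≤-reflexive (suc-injective sz)) = here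
  ⊆⇒◃ (just x  ∷ t) (d       ∷ w) _ sz | q , p with refl ← cell-⊆⁻ {d = d} q =
    there (⊆⇒◃ t w p (suc-injective sz))

  total : Word n → ℕ
  total []            = 0
  total (nothing ∷ w) = total w
  total (just x  ∷ w) = toℕ x + total w

  fill : (t : Word n) → shape t ⋖ A → Fin g → Word n
  fill (nothing ∷ t) here      x = just x ∷ t
  fill (c       ∷ t) (there p) x = c ∷ fill t p x

  ◃-fill : ∀ (t : Word n) (p : shape t ⋖ A) x → t ◃ fill t p x
  ◃-fill (nothing ∷ t) here      x = here
  ◃-fill (nothing ∷ t) (there p) x = there (◃-fill t p x)
  ◃-fill (just y  ∷ t) (there p) x = there (◃-fill t p x)

  shape-fill : ∀ (t : Word n) (p : shape t ⋖ A) x → shape (fill t p x) ≡ A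
  shape-fill (nothing ∷ t) here      x = refl
  shape-fill (nothing ∷ t) (there p) x = cong (outside ∷_) (shape-fill t p x)
  shape-fill (just y  ∷ t) (there p) x = cong (inside ∷_) (shape-fill t p x)

  total-fill : ∀ (t : Word n) (p : shape t ⋖ A) x → total (fill t p x) ≡ toℕ x + total t
  total-fill (nothing ∷ t) here      x = refl
  total-fill (nothing ∷ t) (there p) x = total-fill t p x
  total-fill (just y  ∷ t) (there p) x = begin
    toℕ y + total (fill t p x)  ≡⟨ cong (toℕ y +_) (total-fill t p x) ⟩
    toℕ y + (toℕ x + total t)   ≡⟨ +-assoc (toℕ y) (toℕ x) (total t) ⟨
    toℕ y + toℕ x + total t     ≡⟨ cong (_+ total t) (+-comm (toℕ y) (toℕ x)) ⟩
    toℕ x + toℕ y + total t     ≡⟨ +-assoc (toℕ x) (toℕ y) (total t) ⟩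
    toℕ x + (toℕ y + total t)   ∎
    where open ≡-Reasoning

  -- The shape `A` already determines which group is added, so only its label is free.
  ◃⇒fill : (p : shape t ⋖ A) → t ◃ w → shape w ≡ A → ∃ λ x → w ≡ fill t p x
  ◃⇒fill {t = nothing ∷ t} here      here      eq = _ , refl
  ◃⇒fill {t = nothing ∷ t} (there p) (there q) eq = map₂ (cong (nothing ∷_)) (◃⇒fill p q (∷-injectiveʳ eq))
  ◃⇒fill {t = just y  ∷ t} (there p) (there q) eq = map₂ (cong (just y ∷_)) (◃⇒fill p q (∷-injectiveʳ eq))

-- Linear congruences modulo g

toℕ-mod : ∀ a g .{{_ : NonZero g}} → toℕ (a mod g) ≡ a % g
toℕ-mod a g = toℕ-fromℕ< _

-- The hypothesis makes `b` and `c` opposite modulo `g`. Used with the two in either order, it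
-- yields both existence and uniqueness in `mod-solve`.
mod-cancel : ∀ g .{{_ : NonZero g}} {b c} q → b + c ≡ q * g → ∀ (x : Fin g) →
             (toℕ ((toℕ x + b) mod g) + c) mod g ≡ x
mod-cancel g {b} {c} q eq x = toℕ-injective $ begin
  toℕ ((toℕ y + c) mod g)                 ≡⟨ toℕ-mod (toℕ y + c) g ⟩
  (toℕ y + c) % g                         ≡⟨ cong (λ z → (z + c) % g) (toℕ-mod (toℕ x + b) g) ⟩
  ((toℕ x + b) % g + c) % g               ≡⟨ %-distribˡ-+ ((toℕ x + b) % g) c g ⟩
  ((toℕ x + b) % g % g + c % g) % g       ≡⟨ cong (λ z → (z + c % g) % g) (m%n%n≡m%n (toℕ x + b) g) ⟩
  ((toℕ x + b) % g + c % g) % g           ≡⟨ %-distribˡ-+ (toℕ x + b) c g ⟨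
  (toℕ x + b + c) % g                     ≡⟨ cong (_% g) (+-assoc (toℕ x) b c) ⟩
  (toℕ x + (b + c)) % g                   ≡⟨ cong (λ z → (toℕ x + z) % g) eq ⟩
  (toℕ x + q * g) % g                     ≡⟨ [m+kn]%n≡m%n (toℕ x) q g ⟩
  toℕ x % g                               ≡⟨ m<n⇒m%n≡m (toℕ<n x) ⟩
  toℕ x                                   ∎
  where
  open ≡-Reasoning
  y = (toℕ x + b) mod g

mod-solve : ∀ g .{{_ : NonZero g}} c (i : Fin g) → ∃! _≡_ λ (x : Fin g) → (toℕ x + c) mod g ≡ i
mod-solve g c i = (toℕ i + d) mod g , mod-cancel g c (trans (+-comm d c) c+d) i
                  , λ { {y} refl → mod-cancel g c c+d y }
  where
  -- A natural number congruent to `- c`, which avoids truncated subtraction.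
  d = c * pred g
  c+d : c + d ≡ c * g
  c+d = trans (sym (*-suc c (pred g))) (cong (c *_) (suc-pred g))

-- From a colouring to a large set

-- Supplies a transverse `k`-set; the block through it shows that a class is nonempty.
initialWord : ∀ {g} (x : Fin g) → k ≤ n → ∃ λ (t : Word {g} n) → ∣ shape t ∣ ≡ k
initialWord {n = zero}   x z≤n       = [] , refl
initialWord {n = suc n} x z≤n       with initialWord {n = n} x z≤n
... | t , t# = nothing ∷ t , t#
initialWord             x (s≤s k≤n) with initialWord x k≤n
... | t , t# = just x ∷ t , cong suc t#

largeSet : .{{_ : NonZero g}} → k ≤ n → Colouring n k (Fin g) (Fin m) → LH n g (suc k) k
largeSet {g} {k} {n} {m} k≤n C = record
  { grouping    = fibres n g
  ; number      = m
  ; blocks      = Block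
  ; isHDesign   = λ j → record { transverse = transverse; balanced = λ {R} → bal j R }
  ; isPartition = record
    { nonempty = λ j → let t , t# = initialWord (0 mod g) k≤n
                           b , (b∈ , _) , _ = bal j (points t) (word-transverse t t#)
                       in b , b∈
    ; within   = λ _ → transverse
    ; covers   = cov
    }
  }
  where
  open Colouring C

  wordColour : Word n → Fin m
  wordColour w = colour (shape w) (total w mod g)

  Block : Fin m → Subset (n * g) → Set
  Block j S = ∃ λ w → S ≡ points w × ∣ shape w ∣ ≡ suc k × wordColour w ≡ j

  word-transverse : ∀ {l} (w : Word n) → ∣ shape w ∣ ≡ l → Transverse (fibres n g) l (points w)
  word-transverse w w# = trans (∣points∣ w) w# , points∩fibre w

  transverse : ∀ {j S} → Block j S → Transverse (fibres n g) (suc k) S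
  transverse (w , refl , w# , _) = word-transverse w w#

  bal : ∀ j R → Transverse (fibres n g) k R → ∃! _≡_ λ b → Block j b × R ⊆ b
  bal j R (R# , R∩) with toWord n R R∩
  ... | t , refl with balanced (trans (sym (∣points∣ t)) R#) j
  ...   | (A , i) , (t⋖A , eq) , unique with mod-solve g (total t) i
  ...     | x , x-solves , x-unique =
    points w , ((w , refl , w# , w-colour) , ◃⇒⊆ (◃-fill t t⋖A x)) , same
    where
    w : Word n
    w = fill t t⋖A x
    w# : ∣ shape w ∣ ≡ suc k
    w# = trans (cong ∣_∣ (shape-fill t t⋖A x))
               (trans (⋖-size t⋖A) (cong suc (trans (sym (∣points∣ t)) R#)))
    w-colour : wordColour w ≡ j
    w-colour = trans (cong₂ colour (shape-fill t t⋖A x)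
                                   (trans (cong (_mod g) (total-fill t t⋖A x)) x-solves)) eq
    same : ∀ {b} → Block j b × points t ⊆ b → points w ≡ b
    same ((w′ , refl , w′# , w′-colour) , t⊆w′)
      with t◃w′ ← ⊆⇒◃ t w′ t⊆w′ (trans w′# (cong suc (sym (trans (sym (∣points∣ t)) R#))))
      -- Uniqueness in the colouring identifies both the shape of `w′` with `A` and its label sum
      -- modulo `g` with `i`; only the new label remains to be compared.
      with refl ← unique (◃⇒⋖ t◃w′ , w′-colour)
      with x′ , w′≡ ← ◃⇒fill t⋖A t◃w′ refl
      = cong points (trans (cong (fill t t⋖A) (x-unique (solves x′ w′≡))) (sym w′≡))
      where
      solves : ∀ x′ → w′ ≡ fill t t⋖A x′ → (toℕ x′ + total t) mod g ≡ total w′ mod g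
      solves x′ eq = cong (_mod g) (trans (sym (total-fill t t⋖A x′)) (cong total (sym eq)))

  cov : ∀ {S} → Transverse (fibres n g) (suc k) S → ∃! _≡_ λ j → Block j S
  cov {S} (S# , S∩) with toWord n S S∩
  ... | w , refl = wordColour w , (w , refl , trans (sym (∣points∣ w)) S# , refl) , λ where
    -- A point set has only one word, so its colour is well defined.
    (w′ , eq , _ , refl) → cong wordColour (points-injective w w′ eq)

-- Finite verification of a colouring

sized : ∀ n → ℕ → List (Subset n)
sized zero    zero    = [] ∷ []
sized zero    (suc k) = []
sized (suc n) zero    = List.map (outside ∷_) (sized n zero)
sized (suc n) (suc k) = List.map (inside ∷_) (sized n k) List.++ List.map (outside ∷_) (sized n (suc k))

∈-sized : ∀ (T : Subset n) → ∣ T ∣ ≡ k → T List.∈ sized n k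
∈-sized {k = zero}  []            _  = here refl
∈-sized {k = zero}  (outside ∷ T) T# = ∈-map⁺ (outside ∷_) (∈-sized T T#)
∈-sized {k = suc k} (inside  ∷ T) T# = ∈-++⁺ˡ (∈-map⁺ (inside ∷_) (∈-sized T (suc-injective T#)))
∈-sized {n = suc n} {k = suc k} (outside ∷ T) T# =
  ∈-++⁺ʳ (List.map (inside ∷_) (sized n k)) (∈-map⁺ (outside ∷_) (∈-sized T T#))

extensions : Subset n → List (Subset n)
extensions []            = []
extensions (inside  ∷ T) = List.map (inside ∷_) (extensions T)
extensions (outside ∷ T) = (inside ∷ T) ∷ List.map (outside ∷_) (extensions T)

∈-extensions⁺ : T ⋖ A → A List.∈ extensions T
∈-extensions⁺ here                    = here refl
∈-extensions⁺ (there {s = inside}  p) = ∈-map⁺ (inside ∷_) (∈-extensions⁺ p)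
∈-extensions⁺ (there {s = outside} p) = there (∈-map⁺ (outside ∷_) (∈-extensions⁺ p))

∈-extensions⁻ : ∀ (T : Subset n) → A List.∈ extensions T → T ⋖ A
∈-extensions⁻ (outside ∷ T) (here refl) = here
∈-extensions⁻ (inside  ∷ T) A∈         with _ , A∈′ , refl ← ∈-map⁻ (inside ∷_) A∈ =
  there (∈-extensions⁻ T A∈′)
∈-extensions⁻ (outside ∷ T) (there A∈) with _ , A∈′ , refl ← ∈-map⁻ (outside ∷_) A∈ =
  there (∈-extensions⁻ T A∈′)

occurrences : Fin m → List (X × Fin m) → List (X × Fin m)
occurrences j = filter (λ (_ , i) → i Fin.≟ j)

Exact : List (X × Fin m) → Set
Exact xs = ∀ j → length (occurrences j xs) ≡ 1

exact? : ∀ (xs : List (X × Fin m)) → Dec (Exact xs)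
exact? xs = Fin.all? λ j → length (occurrences j xs) ℕ.≟ 1

-- Every entry with second component `j` survives the filter, whose result is a singleton. Counting
-- thus replaces a search over all candidates.
exact⇒∃! : ∀ {xs : List (X × Fin m)} → Exact xs → ∀ j → ∃! _≡_ λ x → (x , j) List.∈ xs
exact⇒∃! {xs = xs} exact j with occurrences j xs in eq | exact j
... | (x , i) ∷ [] | refl
  with x∈ , refl ← ∈-filter⁻ (λ (_ , i) → i Fin.≟ j) {xs = xs} (subst ((x , i) List.∈_) (sym eq) (here refl)) =
  x , x∈ , same
  where
  same : ∀ {y} → (y , j) List.∈ xs → x ≡ y
  same y∈ with subst ((_ , j) List.∈_) eq (∈-filter⁺ (λ (_ , i) → i Fin.≟ j) y∈ refl)
  ... | here refl = refl

-- The junk value zero is never reached on quadruples, which lie in exactly μ systems.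
nth : List (Fin (suc m)) → Fin μ → Fin (suc m)
nth js i = fromMaybe zero (head (drop (toℕ i) js))

-- A permutation π in Π stands for the system π(D), which contains A iff π⁻¹(A) ∈ D;
-- the characteristic vector of π⁻¹(A) is that of A composed with π.
module _ (D : List (Subset n)) (Π : Vec (Vec (Fin n) n) (suc m)) where

  open DecMembership (≡-dec {n = n} Bool._≟_) using (_∈?_)

  systemsContaining : Subset n → List (Fin (suc m))
  systemsContaining A = filter (λ j → map (lookup A) (lookup Π j) ∈? D) (allFin (suc m))

  -- The list is an argument so that it is evaluated once for all i.
  row : ∀ μ → Subset n → List (Fin (suc m)) → List ((Subset n × Fin μ) × Fin (suc m))
  row μ A js = List.map (λ i → (A , i) , nth js i) (allFin μ)

  -- The graph of the colouring over all `(A , i)` with `T ⋖ A`. For a triple of 10 points it has 7μ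
  -- entries, one for each of the 7μ systems when it is `Exact`.
  table : ∀ μ → Subset n → List ((Subset n × Fin μ) × Fin (suc m))
  table μ T = concatMap (λ A → row μ A (systemsContaining A)) (extensions T)

  ∈-table⁺ : ∀ {i : Fin μ} → T ⋖ A → ((A , i) , nth (systemsContaining A) i) List.∈ table μ T
  ∈-table⁺ {i = i} p = ∈-concatMap⁺ _ (lose (∈-extensions⁺ p) (∈-map⁺ _ (∈-allFin i)))

  ∈-table⁻ : ∀ {i : Fin μ} {j} → ((A , i) , j) List.∈ table μ T →
             T ⋖ A × nth (systemsContaining A) i ≡ j
  ∈-table⁻ {T = T} e∈ with B , B∈ , e∈row ← find (∈-concatMap⁻ _ {xs = extensions T} e∈)
    with _ , _ , refl ← ∈-map⁻ _ e∈row = ∈-extensions⁻ T B∈ , refl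

  balanced? : ∀ k μ → Dec (All (Exact ∘ table μ) (sized n k))
  balanced? k μ = All.all? (exact? ∘ table μ) (sized n k)

  -- Balance is a finite check over all `k`-subsets; when evaluation succeeds, `True` reduces to the
  -- unit type and `_` fills the argument.
  systemsColouring : ∀ k μ → True (balanced? k μ) → Colouring n k (Fin μ) (Fin (suc m))
  systemsColouring k μ checked = record
    { colour   = nth ∘ systemsContaining
    ; balanced = λ {T} T# j →
        let (A , i) , e∈ , unique = exact⇒∃! {xs = table μ T} (All.lookup (toWitness checked) (∈-sized T T#)) j
        in (A , i) , ∈-table⁻ e∈ , λ { {B , i′} (T⋖B , refl) → unique (∈-table⁺ T⋖B) }
    }

-- Explicit systems on ten points

-- Translation of the points by -1 modulo `suc n`, acting on characteristic vectors.
rotate : Subset (suc n) → Subset (suc n)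
rotate (s ∷ S) = S ∷ʳ s

-- The cyclic SQS(10), with three base blocks mod 10.
sqs₁₀ : List (Subset 10)
sqs₁₀ = concatMap (λ B → List.iterate rotate B 10)
  ( ⁅ 0F ⁆ ∪ ⁅ 1F ⁆ ∪ ⁅ 3F ⁆ ∪ ⁅ 4F ⁆
  ∷ ⁅ 0F ⁆ ∪ ⁅ 1F ⁆ ∪ ⁅ 2F ⁆ ∪ ⁅ 6F ⁆
  ∷ ⁅ 0F ⁆ ∪ ⁅ 2F ⁆ ∪ ⁅ 4F ⁆ ∪ ⁅ 7F ⁆
  ∷ [])

-- Lists π, σπ, σ²π and so on, which stand for the successive images of the system of π under σ.
orbit : Vec (Fin n) n → Vec (Fin n) n → ∀ l → Vec (Vec (Fin n) n) l
orbit σ π = Vec.iterate (map (lookup σ)) π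

-- Found by computer search among unions of orbits of a cyclic group ⟨σ⟩ on the 2520
-- labelled SQS(10): order 6 for multiplicity 2 (σ fixes sqs₁₀, which is used twice),
-- order 7 for multiplicity 3.
systems₂ : Vec (Vec (Fin 10) 10) 14
systems₂ = Vec.allFin 10
       ∷ Vec.allFin 10
       ∷ orbit σ (1F ∷ 6F ∷ 0F ∷ 5F ∷ 2F ∷ 9F ∷ 7F ∷ 3F ∷ 4F ∷ 8F ∷ []) 6
      ++ orbit σ (1F ∷ 6F ∷ 0F ∷ 9F ∷ 8F ∷ 2F ∷ 4F ∷ 3F ∷ 5F ∷ 7F ∷ []) 6
  where σ = 5F ∷ 6F ∷ 4F ∷ 2F ∷ 3F ∷ 7F ∷ 0F ∷ 9F ∷ 8F ∷ 1F ∷ []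

systems₃ : Vec (Vec (Fin 10) 10) 21
systems₃ = orbit σ (1F ∷ 0F ∷ 2F ∷ 3F ∷ 4F ∷ 5F ∷ 7F ∷ 9F ∷ 6F ∷ 8F ∷ []) 7
      ++ orbit σ (0F ∷ 1F ∷ 3F ∷ 2F ∷ 4F ∷ 6F ∷ 8F ∷ 9F ∷ 7F ∷ 5F ∷ []) 7
      ++ orbit σ (0F ∷ 1F ∷ 2F ∷ 4F ∷ 6F ∷ 7F ∷ 3F ∷ 5F ∷ 9F ∷ 8F ∷ []) 7
  where σ = 1F ∷ 2F ∷ 3F ∷ 4F ∷ 5F ∷ 6F ∷ 0F ∷ 7F ∷ 8F ∷ 9F ∷ []

-- All multiplicities from 2 and 3

colouring₂ : Colouring 10 3 (Fin 2) (Fin 14)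
colouring₂ = systemsColouring sqs₁₀ systems₂ 3 2 _

colouring₃ : Colouring 10 3 (Fin 3) (Fin 21)
colouring₃ = systemsColouring sqs₁₀ systems₃ 3 3 _

colouring : ∀ g → ∃ λ m → Colouring 10 3 (Fin (2 + g)) (Fin m)
colouring 0             = 14 , colouring₂
colouring 1             = 21 , colouring₃
colouring (suc (suc g)) with m , C ← colouring g =
  -- `2 + suc (suc g)` computes to `2 + (2 + g)`, so putting `colouring₂` first gives the required
  -- index type directly.
  14 + m , reindex (↔-sym +↔⊎) (↔-sym +↔⊎) (colouring₂ ⊎-colouring C)

theorem17 : ∀ (g : ℕ) → g ≥ 2 → LH 10 g 4 3
theorem17 (suc (suc g)) (s≤s (s≤s z≤n)) = largeSet (s≤s (s≤s (s≤s z≤n))) (proj₂ (colouring g))
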